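{- Let $G_1,G_2,\ldots,G_n$ ($n\ge 1$) be a finite sequence of pairwise disjoint connected graphs and let $x_i\in V(G_i)$ for $i=1,\ldots,n$. Let $B(G_1,\ldots,G_n)$ be the bouquet of the graphs $\{G_i\}_{i=1}^n$ with respect to the vertices $\{x_i\}_{i=1}^n$, i.e. the graph obtained from the disjoint union of $G_1,\ldots,G_n$ by identifying all the vertices $x_1,\ldots,x_n$ to a single vertex. Then $$\left(\sum_{i=1}^{n}\gamma_{sp}(G_i)\right)-n+1\leq \gamma_{sp}(B(G_1,\ldots,G_n))\leq \sum_{i=1}^{n}\gamma_{sp}(G_i).$$
   Context: All graphs are finite, simple and undirected. $N(v)$ denotes the open neighbourhood of $v$. For a graph $G=(V,E)$ and $S\subseteq V$ write $\overline{S}=V\setminus S$. A set $S\subseteq V$ is dominating if every vertex of $\overline{S}$ is adjacent to at least one vertex of $S$. A dominating set $S$ is a super dominating set of $G$ if for every $u\in\overline{S}$ there exists $w\in S$ with $N(w)\cap\overline{S}=\{u\}$. The super domination number $\gamma_{sp}(G)$ is the minimum cardinality of a super dominating set of $G$. -}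

module Defs where

open import Level using (0ℓ)
open import Data.Fin.Base using (Fin; zero; suc; punchIn; punchOut)
import Data.Fin.Properties as Fin
open import Data.Fin.Subset as Subset using (Subset; ∣_∣)
open import Data.Fin.Subset.Properties using (_∈?_; ∈⊤; anySubset?)
open import Data.Empty using (⊥-elim-irr)
open import Data.Irrelevant using ([_])
open import Data.Nat.Base using (ℕ; zero; suc; pred; _+_; _≤_; z≤n; s≤s)
import Data.Nat.Properties as ℕ
open import Data.Product.Base using (Σ; ∃; ∃-syntax; _×_; _,_; proj₁; proj₂)
open import Data.Refinement.Base using (Refinement; _,_; value)
open import Data.Sum.Base using (_⊎_; inj₁; inj₂)
open import Data.Sum.Function.Propositional using (_⊎-↔_)
open import Function.Base using (_∘_)
open import Function.Bundles using (_↔_; _⇔_; mk⇔; mk↔ₛ′; Equivalence; Inverse)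
open import Function.Construct.Composition using (_↔-∘_)
open import Function.Construct.Identity using (↔-id)
open import Function.Construct.Symmetry using (↔-sym)
open import Function.Properties.Inverse using (↔⇒↣)
open import Relation.Binary.Construct.Closure.ReflexiveTransitive using (Star)
open import Relation.Binary.Core using (Rel)
import Relation.Binary.Definitions as B
open import Relation.Binary.PropositionalEquality
open import Relation.Nullary using (Dec; yes; no)
open import Relation.Nullary.Negation using (contradiction)
open import Relation.Nullary.Decidable
  using (map′; _×-dec_; _→-dec_; ¬?; via-injection)
open import Relation.Unary using (Pred; Decidable; _∩_; _≐_; ｛_｝)

open import Data.Nat.Properties using (+-0-commutativeMonoid)
open import Algebra.Properties.CommutativeMonoid.Sum +-0-commutativeMonoid public
  using (sum; sum-syntax)

-- Adjacency is required to be decidable, which is no restriction classically.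
record Graph : Set₁ where
  field
    Vertex      : Set
    order       : ℕ
    enumeration : Vertex ↔ Fin order
    Adj         : Rel Vertex 0ℓ
    adj?        : B.Decidable Adj
    adj-sym     : B.Symmetric Adj
    adj-irrefl  : B.Irreflexive _≡_ Adj

  index : Vertex → Fin order
  index = Inverse.to enumeration

  vertex : Fin order → Vertex
  vertex = Inverse.from enumeration

  vertex-index : ∀ v → vertex (index v) ≡ v
  vertex-index = Inverse.strictlyInverseʳ enumeration

  infix 4 _≟_
  _≟_ : B.DecidableEquality Vertex
  _≟_ = via-injection (↔⇒↣ enumeration) Fin._≟_

  all? : {P : Pred Vertex 0ℓ} → Decidable P → Dec (∀ v → P v)
  all? {P} P? = map′ (λ h v → subst P (vertex-index v) (h (index v)))
                     (λ h → h ∘ vertex) (Fin.all? (P? ∘ vertex))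

  any? : {P : Pred Vertex 0ℓ} → Decidable P → Dec (∃ P)
  any? {P} P? = map′ (λ (i , p) → vertex i , p)
                     (λ (v , p) → index v , subst P (sym (vertex-index v)) p)
                     (Fin.any? (P? ∘ vertex))

open Graph public using (Vertex)

module _ (G : Graph) where
  open Graph G hiding (Vertex)

  Connected : Set
  Connected = ∀ u v → Star Adj u v

  -- Sets of vertices are subsets of the index set Fin order, so that their
  -- cardinality is the library's ∣_∣.
  VertexSet : Set
  VertexSet = Subset order

  In Out : VertexSet → Pred (Vertex G) 0ℓ
  In  S v = index v Subset.∈ S
  Out S v = index v Subset.∉ S

  Nbhd : Vertex G → Pred (Vertex G) 0ℓ
  Nbhd w = Adj w

  Dominating : VertexSet → Set
  Dominating S = ∀ u → Out S u → ∃[ w ] In S w × Adj w u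

  SuperDominating : VertexSet → Set
  SuperDominating S =
    Dominating S ×
    (∀ u → Out S u → ∃[ w ] In S w × (Nbhd w ∩ Out S) ≐ ｛ u ｝)

  IsSuperDominationNumber : ℕ → Set
  IsSuperDominationNumber k =
    (∃[ S ] SuperDominating S × ∣ S ∣ ≡ k) ×
    (∀ S → SuperDominating S → k ≤ ∣ S ∣)

  in? : ∀ S → Decidable (In S)
  in? S v = index v ∈? S

  out? : ∀ S → Decidable (Out S)
  out? S v = ¬? (in? S v)

  superDominating? : Decidable SuperDominating
  superDominating? S =
    all? (λ u → out? S u →-dec any? (λ w → in? S w ×-dec adj? w u)) ×-dec
    all? (λ u → out? S u →-dec any? (λ w → in? S w ×-dec private? w u))
    where
    private? : ∀ w u → Dec ((Nbhd w ∩ Out S) ≐ ｛ u ｝)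
    private? w u =
      map′ (λ (f , g) → (λ {v} → f v) , (λ {v} → g v))
           (λ (f , g) → (λ v → f {v}) , (λ v → g {v}))
           (all? (λ v → (adj? w v ×-dec out? S v) →-dec (u ≟ v)) ×-dec
            all? (λ v → (u ≟ v) →-dec (adj? w v ×-dec out? S v)))

  ⊤-superDominating : SuperDominating Subset.⊤
  ⊤-superDominating = (λ u u∉ → contradiction ∈⊤ u∉) , (λ u u∉ → contradiction ∈⊤ u∉)

least : {P : Pred ℕ 0ℓ} → Decidable P → ∀ n → P n →
        ∃[ k ] P k × (∀ j → P j → k ≤ j)
least {P} P? n pn with P? 0
... | yes p0 = 0 , p0 , λ _ _ → z≤n
least P? zero    pn | no ¬p0 = contradiction pn ¬p0
least {P} P? (suc n) pn | no ¬p0 =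
  let k , pk , min = least (P? ∘ suc) n pn in
  suc k , pk , λ { zero p0 → contradiction p0 ¬p0 ; (suc j) pj → s≤s (min j pj) }

superDominationNumber : ∀ G → ∃ (IsSuperDominationNumber G)
superDominationNumber G =
  let k , attained , min = least
        (λ k → anySubset? (λ S → superDominating? G S ×-dec (∣ S ∣ ℕ.≟ k)))
        ∣ Subset.⊤ {Graph.order G} ∣ (Subset.⊤ , ⊤-superDominating G , refl)
  in k , attained , λ S sd → min ∣ S ∣ (S , sd , refl)

γsp : Graph → ℕ
γsp G = proj₁ (superDominationNumber G)

-- The vertices of the bouquet: the vertex hub resulting from the
-- identification of all the xᵢ, and the other vertices of the disjoint union.
data BouquetVertex {n} (V : Fin n → Set) (x : ∀ i → V i) : Set where
  hub : BouquetVertex V x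
  off : ∀ i → Refinement (V i) (_≢ x i) → BouquetVertex V x

punch↔ : ∀ {m} (x : Fin m) → Refinement (Fin m) (_≢ x) ↔ Fin (pred m)
punch↔ {suc m} x = mk↔ₛ′ to from to-from from-to
  where
  away : (r : Refinement (Fin (suc m)) (_≢ x)) → x ≢ value r
  away (v , [ v≢x ]) = λ x≡v → ⊥-elim-irr (v≢x (sym x≡v))
  to : Refinement (Fin (suc m)) (_≢ x) → Fin m
  to r = punchOut (away r)
  from : Fin m → Refinement (Fin (suc m)) (_≢ x)
  from j = punchIn x j , [ Fin.punchInᵢ≢i x j ]
  to-from : ∀ j → to (from j) ≡ j
  to-from j = trans (Fin.punchOut-cong x refl) (Fin.punchOut-punchIn x)
  ext : ∀ {r s : Refinement (Fin (suc m)) (_≢ x)} → value r ≡ value s → r ≡ s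
  ext refl = refl
  from-to : ∀ r → from (to r) ≡ r
  from-to r = ext (Fin.punchIn-punchOut (away r))

delete↔ : ∀ {V : Set} {m} → V ↔ Fin m → (x : V) →
          Refinement V (_≢ x) ↔ Fin (pred m)
delete↔ {V} {m} e x = punch↔ (to x) ↔-∘ mk↔ₛ′ f g f-g g-f
  where
  open Inverse e using (to; from; strictlyInverseˡ; strictlyInverseʳ)
  f : Refinement V (_≢ x) → Refinement (Fin m) (_≢ to x)
  f (v , [ v≢x ]) = to v , [ (λ eq → v≢x (trans (sym (strictlyInverseʳ v))
                                  (trans (cong from eq) (strictlyInverseʳ x)))) ]
  g : Refinement (Fin m) (_≢ to x) → Refinement V (_≢ x)
  g (j , [ j≢x ]) = from j , [ (λ eq → j≢x (trans (sym (strictlyInverseˡ j)) (cong to eq))) ]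
  ext : ∀ {A : Set} {P : A → Set} {r s : Refinement A P} → value r ≡ value s → r ≡ s
  ext refl = refl
  f-g : ∀ r → f (g r) ≡ r
  f-g (j , _) = ext (strictlyInverseˡ j)
  g-f : ∀ r → g (f r) ≡ r
  g-f (v , _) = ext (strictlyInverseʳ v)

Σ↔ : ∀ {n} {A : Fin n → Set} {d : Fin n → ℕ} → (∀ i → A i ↔ Fin (d i)) →
     Σ (Fin n) A ↔ Fin (sum d)
Σ↔ {zero}  e = mk↔ₛ′ (λ ()) (λ ()) (λ ()) (λ ())
Σ↔ {suc n} {A} e = ↔-sym Fin.+↔⊎ ↔-∘ ((e zero ⊎-↔ Σ↔ (e ∘ suc)) ↔-∘ split)
  where
  split : Σ (Fin (suc n)) A ↔ (A zero ⊎ Σ (Fin n) (A ∘ suc))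
  split = mk↔ₛ′ (λ { (zero , a) → inj₁ a ; (suc i , a) → inj₂ (i , a) })
                (λ { (inj₁ a) → zero , a ; (inj₂ (i , a)) → suc i , a })
                (λ { (inj₁ _) → refl ; (inj₂ _) → refl })
                (λ { (zero , _) → refl ; (suc _ , _) → refl })

module _ {n} (G : Fin n → Graph) (x : ∀ i → Vertex (G i)) where

  private
    V : Fin n → Set
    V i = Vertex (G i)

  -- The quotient map from the disjoint union of the graphs.
  inject : ∀ i → V i → BouquetVertex V x
  inject i v with Graph._≟_ (G i) v (x i)
  ... | yes _   = hub
  ... | no  v≢x = off i (v , [ v≢x ])

  inject-hub : ∀ i → inject i (x i) ≡ hub
  inject-hub i with Graph._≟_ (G i) (x i) (x i)
  ... | yes _   = refl
  ... | no  x≢x = contradiction refl x≢x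

  inject-off : ∀ i r → inject i (value r) ≡ off i r
  inject-off i (v , [ v≢x ]) with Graph._≟_ (G i) v (x i)
  ... | yes v≡x = ⊥-elim-irr (v≢x v≡x)
  ... | no  _   = refl

  -- The fibres of inject are exactly those of the identification of the xᵢ:
  -- two elements of the disjoint union are merged iff they are equal or both
  -- of the form (i , xᵢ).
  inject-≡⇔ : ∀ {i j} {u : V i} {v : V j} →
    inject i u ≡ inject j v ⇔
    (_≡_ {A = Σ (Fin n) V} (i , u) (j , v) ⊎ (u ≡ x i × v ≡ x j))
  inject-≡⇔ {i} {j} {u} {v} = mk⇔ to from
    where
    to : inject i u ≡ inject j v →
         _≡_ {A = Σ (Fin n) V} (i , u) (j , v) ⊎ (u ≡ x i × v ≡ x j)
    to eq with Graph._≟_ (G i) u (x i) | Graph._≟_ (G j) v (x j)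
    to eq   | yes p | yes q = inj₂ (p , q)
    to refl | no  _ | no  _ = inj₁ refl
    to ()   | yes _ | no  _
    to ()   | no  _ | yes _
    from : _≡_ {A = Σ (Fin n) V} (i , u) (j , v) ⊎ (u ≡ x i × v ≡ x j) →
           inject i u ≡ inject j v
    from (inj₁ refl)          = refl
    from (inj₂ (refl , refl)) = trans (inject-hub i) (sym (inject-hub j))

  -- The fibre of the hub is inhabited as soon as there is at least one graph.
  inject-surjective : Fin n → ∀ p → ∃[ i ] ∃[ v ] inject i v ≡ p
  inject-surjective i hub       = i , x i , inject-hub i
  inject-surjective _ (off i r) = i , value r , inject-off i r

  BouquetAdj : Rel (BouquetVertex V x) 0ℓ
  BouquetAdj p q =
    ∃[ i ] ∃[ u ] ∃[ v ] inject i u ≡ p × inject i v ≡ q × Graph.Adj (G i) u v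

  inject-injective : ∀ i {u v} → inject i u ≡ inject i v → u ≡ v
  inject-injective i eq with Equivalence.to inject-≡⇔ eq
  ... | inj₁ refl        = refl
  ... | inj₂ (u≡x , v≡x) = trans u≡x (sym v≡x)

  parts↔ : BouquetVertex V x ↔ (Fin 1 ⊎ Σ (Fin n) (λ i → Refinement (V i) (_≢ x i)))
  parts↔ = mk↔ₛ′ (λ { hub → inj₁ zero ; (off i r) → inj₂ (i , r) })
                 (λ { (inj₁ _) → hub ; (inj₂ (i , r)) → off i r })
                 (λ { (inj₁ zero) → refl ; (inj₂ _) → refl })
                 (λ { hub → refl ; (off _ _) → refl })

  bouquetOrder : ℕ
  bouquetOrder = 1 + sum (λ i → pred (Graph.order (G i)))

  bouquetEnumeration : BouquetVertex V x ↔ Fin bouquetOrder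
  bouquetEnumeration =
    ↔-sym Fin.+↔⊎ ↔-∘
    ((↔-id (Fin 1) ⊎-↔ Σ↔ (λ i → delete↔ (Graph.enumeration (G i)) (x i))) ↔-∘ parts↔)

  _≟ᵇ_ : B.DecidableEquality (BouquetVertex V x)
  _≟ᵇ_ = via-injection (↔⇒↣ bouquetEnumeration) Fin._≟_

  bouquetAdj? : B.Decidable BouquetAdj
  bouquetAdj? p q =
    Fin.any? λ i → Graph.any? (G i) λ u → Graph.any? (G i) λ v →
      (inject i u ≟ᵇ p) ×-dec (inject i v ≟ᵇ q) ×-dec Graph.adj? (G i) u v

  bouquetAdj-sym : B.Symmetric BouquetAdj
  bouquetAdj-sym (i , u , v , eu , ev , a) = i , v , u , ev , eu , Graph.adj-sym (G i) a

  bouquetAdj-irrefl : B.Irreflexive _≡_ BouquetAdj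
  bouquetAdj-irrefl p≡q (i , u , v , eu , ev , a) =
    Graph.adj-irrefl (G i) (inject-injective i (trans eu (trans p≡q (sym ev)))) a

  bouquet : Graph
  bouquet = record
    { Vertex      = BouquetVertex V x
    ; order       = bouquetOrder
    ; enumeration = bouquetEnumeration
    ; Adj         = BouquetAdj
    ; adj?        = bouquetAdj?
    ; adj-sym     = bouquetAdj-sym
    ; adj-irrefl  = bouquetAdj-irrefl
    }

{-# OPTIONS --safe #-}
module Submission where

open import Defs
open import Level using (0ℓ)
open import Data.Empty using (⊥)
open import Data.Fin.Base using (Fin; zero; suc; punchIn)
import Data.Fin.Properties as Fin
open import Data.Fin.Subset using (Subset; inside; outside; ∣_∣; ∁; _∈_)
open import Data.Fin.Subset.Properties
  using (x∈∁p⇒x∉p; x∉∁p⇒x∈p; x∉p⇒x∈∁p; ∣∁p∣≡n∸∣p∣; ∣p∣≤n)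
open import Data.Integer.Base as ℤ using (+_)
import Data.Integer.Properties as ℤ
open import Data.Integer.Tactic.RingSolver using (solve-∀)
open import Data.Nat.Base
  using (ℕ; zero; suc; pred; _+_; _∸_; _≤_; _<_; _≥_; z≤n; s≤s; s≤s⁻¹)
open import Data.Nat.Properties hiding (_≟_)
open import Data.Product.Base using (Σ; ∃; ∃-syntax; _×_; _,_; proj₁; proj₂)
open import Data.Sum.Base using (_⊎_; inj₁; inj₂)
open import Data.Unit.Base using (⊤; tt)
open import Data.Vec.Base using (_∷_; here; there; tabulate)
open import Data.Vec.Properties using (lookup∘tabulate; lookup⇒[]=; []=⇒lookup)
open import Algebra.Properties.CommutativeMonoid.Sum +-0-commutativeMonoid using (∑-distrib-+)
open import Algebra.Properties.CommutativeSemigroup +-commutativeSemigroup using (x∙yz≈y∙xz)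
open import Function.Base using (_∘_; id)
open import Function.Bundles using (_↔_; Equivalence; Injection; Inverse)
open import Function.Definitions using (Injective)
open import Function.Properties.Inverse using (↔-refl; ↔-sym; ↔⇒↣)
open import Relation.Binary.PropositionalEquality hiding (J)
open import Relation.Nullary using (Dec; yes; no; does; ¬_; contradiction)
open import Relation.Nullary.Decidable using (_⊎-dec_; dec-true)
open import Relation.Unary using (Pred; Decidable; _∩_; _≐_; ｛_｝)

-- Choosing a private neighbour in S for every vertex outside S shows that the
-- largest matching left k — right k with no further edge left k — right l and
-- no common end left k ≡ right l has order − γsp edges. This notion is symmetric
-- in left and right. Every edge of a bouquet lies in one summand, so a matching
-- of the bouquet splits into matchings of the summands: this is the lower bound.
-- For the upper bound, glue largest matchings of the summands after removing the
-- edge at xᵢ from all of them but one, j: if some matching avoids xᵢ, let j be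
-- such an index; otherwise swap sides so that each xᵢ is a right end, and then
-- no left end of a trimmed matching is adjacent to the hub.

private
  variable
    m n : ℕ
    I J : Set

-- Subsets of finite sets and their enumeration.

select : {P : Pred (Fin n) 0ℓ} → Decidable P → Subset n
select P? = tabulate (does ∘ P?)

∈-select⁺ : {P : Pred (Fin n) 0ℓ} (P? : Decidable P) → ∀ {i} → P i → i ∈ select P?
∈-select⁺ P? {i} p =
  lookup⇒[]= i _ (trans (lookup∘tabulate (does ∘ P?) i) (dec-true (P? i) p))

∈-select⁻ : {P : Pred (Fin n) 0ℓ} (P? : Decidable P) → ∀ {i} → i ∈ select P? → P i
∈-select⁻ P? {i} i∈ with P? i | trans (sym (lookup∘tabulate (does ∘ P?) i)) ([]=⇒lookup i∈)
... | yes p | _  = p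
... | no  _ | ()

-- This makes `Fin ∣ S ∣` an index type for the members of `S`, so that a matching can be indexed by
-- them.
enumerate : (S : Subset n) → Fin ∣ S ∣ → Fin n
enumerate (outside ∷ S) k       = suc (enumerate S k)
enumerate (inside  ∷ S) zero    = zero
enumerate (inside  ∷ S) (suc k) = suc (enumerate S k)

enumerate-∈ : (S : Subset n) → ∀ k → enumerate S k ∈ S
enumerate-∈ (outside ∷ S) k       = there (enumerate-∈ S k)
enumerate-∈ (inside  ∷ S) zero    = here
enumerate-∈ (inside  ∷ S) (suc k) = there (enumerate-∈ S k)

enumerate-injective : (S : Subset n) → Injective _≡_ _≡_ (enumerate S)
enumerate-injective (outside ∷ S) eq = enumerate-injective S (Fin.suc-injective eq)
enumerate-injective (inside  ∷ S) {zero}  {zero}  _  = refl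
enumerate-injective (inside  ∷ S) {suc k} {suc l} eq =
  cong suc (enumerate-injective S (Fin.suc-injective eq))

enumerate-surjective : (S : Subset n) → ∀ {i} → i ∈ S → ∃[ k ] enumerate S k ≡ i
enumerate-surjective (inside  ∷ S) here = zero , refl
enumerate-surjective (outside ∷ S) (there i∈S) =
  let k , eq = enumerate-surjective S i∈S in k , cong suc eq
enumerate-surjective (inside  ∷ S) (there i∈S) =
  let k , eq = enumerate-surjective S i∈S in suc k , cong suc eq

section-injective : {g : J → I} (s : ∀ i → ∃[ j ] g j ≡ i) →
                    Injective _≡_ _≡_ (proj₁ ∘ s)
section-injective {g = g} s {i} {j} eq =
  trans (sym (proj₂ (s i))) (trans (cong g eq) (proj₂ (s j)))

injective⇒≤∣∣ : (f : Fin m → Fin n) → Injective _≡_ _≡_ f →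
                (S : Subset n) → (∀ k → f k ∈ S) → m ≤ ∣ S ∣
injective⇒≤∣∣ f f-inj S f∈S = Fin.injective⇒≤ {f = λ k → proj₁ (rank k)} λ {k} {l} eq →
  f-inj (trans (sym (proj₂ (rank k))) (trans (cong (enumerate S) eq) (proj₂ (rank l))))
  where
  rank : ∀ k → ∃[ j ] enumerate S j ≡ f k
  rank k = enumerate-surjective S (f∈S k)

finSum↔ : (d : Fin n → ℕ) → Σ (Fin n) (Fin ∘ d) ↔ Fin (sum d)
finSum↔ d = Σ↔ (λ i → ↔-refl)

-- Finite sums of natural numbers.

sum-mono-≤ : {f g : Fin n → ℕ} → (∀ i → f i ≤ g i) → sum f ≤ sum g
sum-mono-≤ {zero}  f≤g = z≤n
sum-mono-≤ {suc n} f≤g = +-mono-≤ (f≤g zero) (sum-mono-≤ (f≤g ∘ suc))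

-- In the upper bound the strict index is the untrimmed summand; the unit gained there pays for the
-- hub.
sum-mono-< : {f g : Fin n → ℕ} → (∀ i → f i ≤ g i) → ∀ j → f j < g j → sum f < sum g
sum-mono-< f≤g zero    f<g = +-mono-<-≤ f<g (sum-mono-≤ (f≤g ∘ suc))
sum-mono-< f≤g (suc j) f<g = +-mono-≤-< (f≤g zero) (sum-mono-< (f≤g ∘ suc) j f<g)

sum-suc : (f : Fin n → ℕ) → sum (suc ∘ f) ≡ n + sum f
sum-suc {zero}  f = refl
sum-suc {suc n} f = cong suc (begin
  f zero + sum (suc ∘ f ∘ suc)  ≡⟨ cong (λ h → f zero + h) (sum-suc (f ∘ suc)) ⟩
  f zero + (n + sum (f ∘ suc))  ≡⟨ x∙yz≈y∙xz (f zero) n _ ⟩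
  n + (f zero + sum (f ∘ suc))  ∎)
  where open ≡-Reasoning

-- Matchings and their correspondence with super dominating sets.

record Matching (G : Graph) (I : Set) : Set where
  open Graph G using (Adj)
  field
    left right : I → Vertex G
    matched    : ∀ k → Adj (left k) (right k)
    induced    : ∀ {k l} → Adj (left k) (right l) → k ≡ l
    disjoint   : ∀ k l → left k ≢ right l

  -- If two right ends coincide, the left partner of one is adjacent to the other, and `induced`
  -- identifies the indices.
  right-injective : Injective _≡_ _≡_ right
  right-injective {k} eq = induced (subst (Adj (left k)) eq (matched k))

open Matching

module _ {G : Graph} where
  open Graph G hiding (Vertex)

  index-injective : Injective _≡_ _≡_ index
  index-injective = Injection.injective (↔⇒↣ enumeration)

  restrict : (f : J → I) → Injective _≡_ _≡_ f → Matching G I → Matching G J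
  restrict f f-inj M = record
    { left     = left M ∘ f
    ; right    = right M ∘ f
    ; matched  = matched M ∘ f
    ; induced  = f-inj ∘ induced M
    ; disjoint = λ k l → disjoint M (f k) (f l)
    }

  swap : Matching G I → Matching G I
  swap M = record
    { left     = right M
    ; right    = left M
    ; matched  = adj-sym ∘ matched M
    ; induced  = sym ∘ induced M ∘ adj-sym
    ; disjoint = λ k l eq → disjoint M l k (sym eq)
    }

  Touches : Matching G I → Vertex G → I → Set
  Touches M x k = left M k ≡ x ⊎ right M k ≡ x

  touched? : (M : Matching G (Fin m)) → ∀ x → Dec (∃ (Touches M x))
  touched? M x = Fin.any? λ k → (left M k ≟ x) ⊎-dec (right M k ≟ x)

  -- With `x` on the right, `disjoint` keeps left ends away from `x`, and by `induced` only the
  -- partner of `x` among them is adjacent to it.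
  orient : ∀ {x} (M : Matching G I) → ∃ (Touches M x) →
           Σ (Matching G I) λ M′ → ∃[ k ] right M′ k ≡ x
  orient M (k , inj₁ eq) = swap M , k , eq
  orient M (k , inj₂ eq) = M , k , eq

  -- The right ends are the vertices outside `S`, the left ends their witnesses in `S`. One
  -- inclusion of the private neighbourhood condition yields `matched`, the other `induced`.
  superDominating⇒matching : ∀ S → SuperDominating G S → Matching G (Fin ∣ ∁ S ∣)
  superDominating⇒matching S (_ , private′) = record
    { left     = proj₁ ∘ partner
    ; right    = outer
    ; matched  = λ k → proj₁ (proj₂ (proj₂ (proj₂ (partner k))) refl)
    ; induced  = λ {k} {l} adj → outer-injective
                   (proj₁ (proj₂ (proj₂ (partner k))) (adj , outer-out l))
    ; disjoint = λ k l eq → outer-out l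
                   (subst (In G S) eq (proj₁ (proj₂ (partner k))))
    }
    where
    outer : Fin ∣ ∁ S ∣ → Vertex G
    outer k = vertex (enumerate (∁ S) k)

    index-outer : ∀ k → index (outer k) ≡ enumerate (∁ S) k
    index-outer k = Inverse.strictlyInverseˡ enumeration _

    outer-out : ∀ k → Out G S (outer k)
    outer-out k = x∈∁p⇒x∉p (subst (_∈ ∁ S) (sym (index-outer k)) (enumerate-∈ (∁ S) k))

    outer-injective : Injective _≡_ _≡_ outer
    outer-injective {k} {l} eq = enumerate-injective (∁ S)
      (trans (sym (index-outer k)) (trans (cong index eq) (index-outer l)))

    partner : ∀ k → _
    partner k = private′ (outer k) (outer-out k)

  module _ (M : Matching G (Fin m)) where

    rightEnd? : Decidable (λ i → ∃[ k ] index (right M k) ≡ i)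
    rightEnd? i = Fin.any? λ k → index (right M k) Fin.≟ i

    rightEnds : VertexSet G
    rightEnds = select rightEnd?

    -- Each `left M k` serves as the witness for `right M k`: it is no right end by `disjoint`, and
    -- by `induced` it sees no other right end.
    rightEnds-complement-superDominating : SuperDominating G (∁ rightEnds)
    rightEnds-complement-superDominating = dominating , private′
      where
      end : ∀ {u} → Out G (∁ rightEnds) u → ∃[ k ] right M k ≡ u
      end u∉ = let k , eq = ∈-select⁻ rightEnd? (x∉∁p⇒x∈p u∉)
               in k , index-injective eq

      left-in : ∀ k → In G (∁ rightEnds) (left M k)
      left-in k = x∉p⇒x∈∁p λ k∈ →
        let l , eq = ∈-select⁻ rightEnd? k∈
        in disjoint M k l (sym (index-injective eq))

      dominating : Dominating G (∁ rightEnds)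
      dominating u u∉ with end u∉
      ... | k , refl = left M k , left-in k , matched M k

      private′ : ∀ u → Out G (∁ rightEnds) u →
        ∃[ w ] In G (∁ rightEnds) w × (Nbhd G w ∩ Out G (∁ rightEnds)) ≐ ｛ u ｝
      private′ u u∉ with end u∉
      ... | k , refl = left M k , left-in k , only , λ { refl → matched M k , u∉ }
        where
        only : ∀ {v} → (Nbhd G (left M k) ∩ Out G (∁ rightEnds)) v → right M k ≡ v
        only (adj , v∉) with end v∉
        ... | l , refl = cong (right M) (induced M adj)

    superDomination+size≤order : ∀ {γ} → IsSuperDominationNumber G γ → γ + m ≤ order
    superDomination+size≤order {γ} (_ , minimal) = begin
      γ + m                                  ≤⟨ +-mono-≤ γ≤ m≤ ⟩
      ∣ ∁ rightEnds ∣ + ∣ rightEnds ∣        ≡⟨ cong (_+ ∣ rightEnds ∣) (∣∁p∣≡n∸∣p∣ rightEnds) ⟩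
      order ∸ ∣ rightEnds ∣ + ∣ rightEnds ∣  ≡⟨ m∸n+n≡m (∣p∣≤n rightEnds) ⟩
      order                                  ∎
      where
      open ≤-Reasoning
      γ≤ : γ ≤ ∣ ∁ rightEnds ∣
      γ≤ = minimal _ rightEnds-complement-superDominating
      m≤ : m ≤ ∣ rightEnds ∣
      m≤ = injective⇒≤∣∣ (index ∘ right M)
             (right-injective M ∘ index-injective)
             rightEnds (λ k → ∈-select⁺ rightEnd? (k , refl))

-- A minimum super dominating set attains equality in `superDomination+size≤order`, so its matching
-- is largest.
maximumMatching : ∀ {G γ} → IsSuperDominationNumber G γ →
                  ∃[ m ] Matching G (Fin m) × γ + m ≡ Graph.order G
maximumMatching ((S , sd , refl) , _) =
  ∣ ∁ S ∣ , superDominating⇒matching S sd ,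
  trans (cong (λ h → ∣ S ∣ + h) (∣∁p∣≡n∸∣p∣ S)) (m+[n∸m]≡n (∣p∣≤n S))

-- Trimming the matchings of the summands.

-- What is glued in for one summand: AllTouched says that the matchings of all the
-- summands meet the hub, Whole that this summand is the one left untrimmed.
record Part (G : Graph) (x : Vertex G) (m : ℕ) (AllTouched Whole : Set) : Set where
  open Graph G using (Adj)
  field
    size     : ℕ
    matching : Matching G (Fin size)
    deficit  : m ≤ suc size
    whole    : Whole → m ≤ size
    left≢x   : ∀ k → left matching k ≢ x
    adjacent : AllTouched → ∀ k → Adj (left matching k) x → Whole
    right≡x  : ∀ k → right matching k ≡ x → AllTouched × Whole

module _ {G : Graph} {x : Vertex G} {C W : Set} where

  -- A remaining edge with left end adjacent to `x`, or with right end `x`, would have index `k` by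
  -- `induced`; but `punchIn k` skips `k`.
  trimmed : ¬ W → (M : Matching G (Fin m)) → ∀ k → right M k ≡ x → Part G x m C W
  trimmed {suc m} ¬w M k eq = record
    { size     = m
    ; matching = restrict (punchIn k) (Fin.punchIn-injective k _ _) M
    ; deficit  = ≤-refl
    ; whole    = λ w → contradiction w ¬w
    ; left≢x   = λ l eq′ → disjoint M _ k (trans eq′ (sym eq))
    ; adjacent = λ _ l adj → contradiction
                   (induced M (subst (Graph.Adj G _) (sym eq) adj)) (Fin.punchInᵢ≢i k l)
    ; right≡x  = λ l eq′ → contradiction
                   (right-injective M (trans eq′ (sym eq))) (Fin.punchInᵢ≢i k l)
    }

  touched : C → W → (M : Matching G (Fin m)) → ∀ k → right M k ≡ x → Part G x m C W
  touched {m} c w M k eq = record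
    { size     = m
    ; matching = M
    ; deficit  = n≤1+n m
    ; whole    = λ _ → ≤-refl
    ; left≢x   = λ l eq′ → disjoint M l k (trans eq′ (sym eq))
    ; adjacent = λ _ _ _ → w
    ; right≡x  = λ _ _ → c , w
    }

  -- A left end may still be adjacent to `x`. This is harmless: without `C` no part has `x` as a
  -- right end.
  untouched : ¬ C → (M : Matching G (Fin m)) → ¬ ∃ (Touches M x) → Part G x m C W
  untouched {m} ¬c M ¬t = record
    { size     = m
    ; matching = M
    ; deficit  = n≤1+n m
    ; whole    = λ _ → ≤-refl
    ; left≢x   = λ l eq → ¬t (l , inj₁ eq)
    ; adjacent = λ c → contradiction c ¬c
    ; right≡x  = λ l eq → contradiction (l , inj₂ eq) ¬t
    }

-- Splitting and gluing matchings of a bouquet.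

module _ {n} (G : Fin n → Graph) (x : ∀ i → Vertex (G i)) where

  private
    B : Graph
    B = bouquet G x

    p : Fin n → ℕ
    p i = pred (Graph.order (G i))

    order-suc : ∀ i → Graph.order (G i) ≡ suc (p i)
    -- The index of `x i` excludes order zero, so `pred` does not truncate.
    order-suc i with Graph.order (G i) | Graph.index (G i) (x i)
    ... | suc _ | _ = refl

  module _ (M : Matching B I) where

    Lift : Fin n → I → Set
    Lift i k = ∃[ u ] ∃[ v ] inject G x i u ≡ left M k × inject G x i v ≡ right M k
                             × Graph.Adj (G i) u v

    -- An edge of `G i` between lifted ends maps to an edge of the bouquet, and equal lifts have
    -- equal images, so both restrictions pull back.
    liftMatching : ∀ {i} (f : J → I) → Injective _≡_ _≡_ f →
                   (∀ j → Lift i (f j)) → Matching (G i) J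
    liftMatching {i = i} f f-inj e = record
      { left     = λ j → proj₁ (e j)
      ; right    = λ j → proj₁ (proj₂ (e j))
      ; matched  = λ j → proj₂ (proj₂ (proj₂ (proj₂ (e j))))
      ; induced  = λ {j} {k} adj → f-inj (induced M
                     (i , _ , _ , proj₁ (proj₂ (proj₂ (e j)))
                        , proj₁ (proj₂ (proj₂ (proj₂ (e k)))) , adj))
      ; disjoint = λ j k eq → disjoint M (f j) (f k)
                     (trans (sym (proj₁ (proj₂ (proj₂ (e j)))))
                       (trans (cong (inject G x i) eq) (proj₁ (proj₂ (proj₂ (proj₂ (e k)))))))
      }

  module _ {K : Fin n → Set} (N : ∀ i → Matching (G i) (K i))
           (left≢x : ∀ i k → left (N i) k ≢ x i)
           (hub-edges : ∀ i j {k l} → Graph.Adj (G i) (left (N i) k) (x i) →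
                        right (N j) l ≡ x j → i ≡ j) where

    -- Distinct summands meet only in the hub. No left end is the hub, so an unwanted edge between
    -- summands must join a left end to the hub as a right end, which `hub-edges` forbids.
    glue : Matching B (Σ (Fin n) K)
    glue = record
      { left     = λ (i , k) → inject G x i (left (N i) k)
      ; right    = λ (i , k) → inject G x i (right (N i) k)
      ; matched  = λ (i , k) → i , _ , _ , refl , refl , matched (N i) k
      ; induced  = λ {a} {b} (_ , _ , _ , eu , ev , adj) → glue-induced a b eu ev adj
      ; disjoint = glue-disjoint
      }
      where
      glue-induced : ∀ ((i , k) (j , l) : Σ (Fin n) K) {h u v} →
        inject G x h u ≡ inject G x i (left (N i) k) →
        inject G x h v ≡ inject G x j (right (N j) l) →
        Graph.Adj (G h) u v → (i , k) ≡ (j , l)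
      glue-induced (i , k) (j , l) eu ev adj
        with Equivalence.to (inject-≡⇔ G x) eu | Equivalence.to (inject-≡⇔ G x) ev
      ... | inj₂ (_ , eq) | _ = contradiction eq (left≢x i k)
      ... | inj₁ refl | inj₁ refl = cong (i ,_) (induced (N i) adj)
      -- The edge ends at `x i`, while the right end in question is `x j`: both are the hub.
      ... | inj₁ refl | inj₂ (refl , eq) with hub-edges i j adj eq
      ...   | refl = cong (i ,_) (induced (N i) (subst (Graph.Adj (G i) _) (sym eq) adj))

      glue-disjoint : ∀ ((i , k) (j , l) : Σ (Fin n) K) →
        inject G x i (left (N i) k) ≢ inject G x j (right (N j) l)
      glue-disjoint (i , k) (j , l) eq with Equivalence.to (inject-≡⇔ G x) eq
      ... | inj₁ same with refl ← cong proj₁ same =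
        disjoint (N i) k l (inject-injective G x i eq)
      ... | inj₂ (eq , _) = left≢x i k eq

  -- The two bounds by counting.

  module _ {γ : Fin n → ℕ} {β : ℕ} (isγ : ∀ i → IsSuperDominationNumber (G i) (γ i))
           (isβ : IsSuperDominationNumber B β) where

    -- The orders of the summands add up to `n + sum p`, while the bouquet has order `suc (sum p)`;
    -- the difference produces the correction in the bound.
    lowerBound : suc (sum γ) ≤ n + β
    lowerBound with maximumMatching isβ
    ... | m , M , γ+m = +-cancelʳ-≤ m _ _ (begin
      suc (sum γ) + m                  ≤⟨ s≤s (+-monoʳ-≤ (sum γ) m≤sizes) ⟩
      suc (sum γ + sum size)           ≡⟨ cong suc (∑-distrib-+ γ size) ⟨
      suc (∑[ i < n ] (γ i + size i))  ≤⟨ s≤s (sum-mono-≤ bound) ⟩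
      suc (sum (λ i → suc (p i)))      ≡⟨ cong suc (sum-suc p) ⟩
      suc (n + sum p)                  ≡⟨ +-suc n (sum p) ⟨
      n + suc (sum p)                  ≡⟨ cong (λ h → n + h) γ+m ⟨
      n + (β + m)                      ≡⟨ +-assoc n _ m ⟨
      n + β + m                        ∎)
      where
      open ≤-Reasoning
      part : Fin m → Fin n
      part k = proj₁ (matched M k)

      inPart? : ∀ i → Decidable (λ k → part k ≡ i)
      inPart? i k = part k Fin.≟ i

      fibre : Fin n → Subset m
      fibre i = select (inPart? i)

      size : Fin n → ℕ
      size i = ∣ fibre i ∣

      -- Each edge is found in the fibre of the summand that `matched` assigns to it.
      m≤sizes : m ≤ sum size
      m≤sizes = Fin.injective⇒≤ {f = Inverse.to (finSum↔ size) ∘ proj₁ ∘ locate}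
        (section-injective locate ∘ Injection.injective (↔⇒↣ (finSum↔ size)))
        where
        locate : ∀ k → ∃[ (i , j) ] enumerate (fibre i) j ≡ k
        locate k = let j , eq = enumerate-surjective (fibre (part k)) (∈-select⁺ (inPart? _) refl)
                   in (part k , j) , eq

      bound : ∀ i → γ i + size i ≤ suc (p i)
      bound i = ≤-trans (superDomination+size≤order (liftMatching M (enumerate (fibre i))
                          (enumerate-injective (fibre i)) λ j →
                          subst (λ h → Lift M h (enumerate (fibre i) j))
                            (∈-select⁻ (inPart? i) (enumerate-∈ (fibre i) j))
                            (proj₂ (matched M (enumerate (fibre i) j)))) (isγ i))
                        (≤-reflexive (order-suc i))

    private
      μ : Fin n → ℕ
      μ i = proj₁ (maximumMatching {G i} (isγ i))

      M : ∀ i → Matching (G i) (Fin (μ i))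
      M i = proj₁ (proj₂ (maximumMatching {G i} (isγ i)))

      γ+μ : ∀ i → γ i + μ i ≡ Graph.order (G i)
      γ+μ i = proj₂ (proj₂ (maximumMatching {G i} (isγ i)))

    module _ {C : Set} (j : Fin n) (part : ∀ i → Part (G i) (x i) (μ i) C (i ≡ j)) where
      open module P i = Part (part i)

      -- Each `γ i + μ i` is `suc (p i)`. Trimming costs at most this extra unit, and summand `j`
      -- keeps it.
      upperBound-parts : β ≤ sum γ
      upperBound-parts = +-cancelʳ-≤ (sum size) _ _ (begin
        β + sum size               ≤⟨ superDomination+size≤order glued isβ ⟩
        suc (sum p)                ≤⟨ sum-mono-< {f = p} p≤ j (p< j (whole j refl)) ⟩
        ∑[ i < n ] (γ i + size i)  ≡⟨ ∑-distrib-+ γ size ⟩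
        sum γ + sum size           ∎)
        where
        open ≤-Reasoning
        glued : Matching B (Fin (sum size))
        glued = restrict (Inverse.from (finSum↔ size))
          (Injection.injective (↔⇒↣ (↔-sym (finSum↔ size))))
          -- A right end at the hub gives `C` and lies in summand `j`; given `C`, a left end
          -- adjacent to the hub lies there too.
          (glue matching left≢x λ i h adj eq →
            let c , h≡j = right≡x h _ eq in trans (adjacent i c _ adj) (sym h≡j))

        p< : ∀ i {k} → μ i ≤ k → p i < γ i + k
        p< i {k} μ≤k = begin
          suc (p i)            ≡⟨ order-suc i ⟨
          Graph.order (G i)    ≡⟨ γ+μ i ⟨
          γ i + μ i            ≤⟨ +-monoʳ-≤ (γ i) μ≤k ⟩
          γ i + k              ∎

        p≤ : ∀ i → p i ≤ γ i + size i
        p≤ i = s≤s⁻¹ (≤-trans (p< i (deficit i)) (≤-reflexive (+-suc (γ i) (size i))))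

    upperBound : Fin n → β ≤ sum γ
    upperBound j with Fin.all? (λ i → touched? (M i) (x i))
    -- When every matching touches its `x i`, any summand may be the untrimmed one.
    ... | yes t = upperBound-parts {⊤} j part
      where
      part : ∀ i → Part (G i) (x i) (μ i) ⊤ (i ≡ j)
      part i with i Fin.≟ j | orient (M i) (t i)
      ... | yes i≡j | N , k , eq = touched tt i≡j N k eq
      ... | no  i≢j | N , k , eq = trimmed i≢j N k eq
    ... | no ¬t with Fin.¬∀⟶∃¬ n _ (λ i → touched? (M i) (x i)) ¬t
    -- The matching of summand `h` avoids the hub, so it stays whole while every touching one is
    -- trimmed.
    ...   | h , ¬th = upperBound-parts {⊥} h part
      where
      part : ∀ i → Part (G i) (x i) (μ i) ⊥ (i ≡ h)
      part i with touched? (M i) (x i)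
      ... | no  ¬ti = untouched id (M i) ¬ti
      ... | yes ti with orient (M i) ti
      ...   | N , k , eq = trimmed (λ { refl → ¬th ti }) N k eq

-- Passage to the integers and conclusion.

i-j+1≤k : ∀ {i j k} → suc i ≤ j + k → (+ i ℤ.- + j) ℤ.+ + 1 ℤ.≤ + k
i-j+1≤k {i} {j} {k} i<j+k = begin
  -- `+ 1 ℤ.+ + i` computes to `+ suc i`, so the ring identity fits as it stands.
  (+ i ℤ.- + j) ℤ.+ + 1   ≡⟨ rearrange (+ i) (+ j) ⟩
  + suc i ℤ.- + j         ≤⟨ ℤ.+-monoˡ-≤ (ℤ.- + j) (ℤ.+≤+ i<j+k) ⟩
  + (j + k) ℤ.- + j       ≡⟨ cancel (+ j) (+ k) ⟩
  + k                     ∎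
  where
  open ℤ.≤-Reasoning
  rearrange : ∀ a b → (a ℤ.- b) ℤ.+ + 1 ≡ (+ 1 ℤ.+ a) ℤ.- b
  rearrange = solve-∀
  cancel : ∀ a b → (a ℤ.+ b) ℤ.- a ≡ b
  cancel = solve-∀

corollary4p3 : ∀ (n : ℕ) → n ≥ 1 →
    (G : Fin n → Graph) → (∀ i → Connected (G i)) →
    (x : ∀ i → Vertex (G i)) →
    ((+ (∑[ i < n ] γsp (G i)) ℤ.- + n) ℤ.+ + 1 ℤ.≤ + γsp (bouquet G x))
    × (γsp (bouquet G x) ≤ ∑[ i < n ] γsp (G i))
corollary4p3 (suc n) _ G _ x =
  i-j+1≤k {j = suc n} (lowerBound G x isγ isβ) ,
  -- `zero` is the summand that `n ≥ 1` provides.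
  upperBound G x isγ isβ zero
  where
  isγ : ∀ i → IsSuperDominationNumber (G i) (γsp (G i))
  isγ i = proj₂ (superDominationNumber (G i))
  isβ : IsSuperDominationNumber (bouquet G x) (γsp (bouquet G x))
  isβ = proj₂ (superDominationNumber (bouquet G x))
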